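{- Let $\mathcal{L}$ be a finite relational language with no unary relation symbols, let $\mathbf{K}$ be an infinite $\mathcal{L}$-structure, and let $d$ be a positive integer. Suppose that every substructure of $\mathbf{K}$ of cardinality $d$ has finite big Ramsey degree in $\mathbf{K}$. Then there is a finite list of $d$-ary relations on $\mathbf{K}$ up to restriction; that is, there is a finite set $\mathcal{R}$ of $d$-ary relations on $\mathbf{K}$ such that for every $d$-ary relation $R$ on $\mathbf{K}$ there are $\tilde R\in\mathcal{R}$ and $\mathbf{K}'\in\binom{\mathbf{K}}{\mathbf{K}}$ with $R\upharpoonright\mathbf{K}'=\tilde R\upharpoonright\mathbf{K}'$.
   Context: A relational structure is a set together with relations of finite arity; the same symbol denotes a structure and its universe. An embedding of $\mathbf{A}$ into $\mathbf{B}$ (structures in the same relational signature) is an injection $f$ such that for every relation symbol $R$, $R^{\mathbf{A}}(a_1,\dots,a_n)\iff R^{\mathbf{B}}(f(a_1),\dots,f(a_n))$. A copy of $\mathbf{A}$ in $\mathbf{B}$ is the image of an embedding of $\mathbf{A}$ into $\mathbf{B}$, and $\binom{\mathbf{B}}{\mathbf{A}}$ is the set of copies of $\mathbf{A}$ in $\mathbf{B}$. For an infinite structure $\mathbf{K}$ and a finite substructure $\mathbf{A}$ of $\mathbf{K}$, the big Ramsey degree $t(\mathbf{A},\mathbf{K})$, if it exists, is the smallest integer $t$ such that for every $k\in\omega$ and every $c:\binom{\mathbf{K}}{\mathbf{A}}\to k$ there is $\mathbf{K}'\in\binom{\mathbf{K}}{\mathbf{K}}$ with $\left|c\left[\binom{\mathbf{K}'}{\mathbf{A}}\right]\right|\le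 t$; if it exists, $\mathbf{A}$ is said to have finite big Ramsey degree in $\mathbf{K}$. For a $d$-ary relation $R$ on $\mathbf{K}$, $R\upharpoonright\mathbf{K}'=R\cap(\mathbf{K}')^d$. -}

module Defs where

open import Data.Fin.Base using (Fin)
open import Data.Fin.Subset using (Subset; _∈_; ∣_∣)
open import Data.Nat.Base using (ℕ; _≤_)
open import Data.Product.Base using (Σ; ∃-syntax; _×_; _,_; proj₁; proj₂)
open import Data.Refinement using (Refinement; value; value-injective)
open import Data.Unit.Base using (tt)
open import Data.Vec.Base using (Vec; map)
open import Data.Vec.Properties using (map-∘)
open import Data.Vec.Relation.Unary.All using (All)
open import Function.Base using (_∘_)
open import Function.Bundles using (_↔_; _⇔_; mk⇔; Func; Equivalence)
open import Function.Construct.Identity using (⇔-id)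
open import Function.Definitions using (Injective)
open import Level using (Level; 0ℓ; suc)
open import Relation.Binary.Bundles using (Setoid)
open import Relation.Binary.PropositionalEquality using (_≡_; _≢_; refl; cong; subst; sym; setoid)
import Relation.Binary.Construct.On as On
open import Relation.Nullary.Negation using (¬_)
open import Relation.Unary using (Pred; U; _≐_; _∩_)
open import Relation.Unary.Relation.Binary.Equality using (≐-setoid)

private
  variable
    ℓ : Level

HasCardinality : Set → ℕ → Set
HasCardinality X n = Fin n ↔ X

Finite : Set → Set
Finite X = ∃[ n ] HasCardinality X n

Infinite : Set → Set
Infinite X = ¬ Finite X

image : {X Y : Set} → (X → Y) → Pred X 0ℓ → Pred Y 0ℓ
image f P y = ∃[ x ] P x × f x ≡ y

HasCardinality≤ : {k : ℕ} → Pred (Fin k) ℓ → ℕ → Set ℓ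
HasCardinality≤ {k = k} P t = ∃[ C ] P ≐ (_∈ C) × ∣ C ∣ ≤ t

record Language : Set₁ where
  field
    Symbol : Set
    arity  : Symbol → ℕ

open Language public

FiniteLanguage : Language → Set
FiniteLanguage L = Finite (Symbol L)

NoUnarySymbols : Language → Set
NoUnarySymbols L = ∀ R → arity L R ≢ 1

-- Tuples are vectors rather than functions out of Fin n, so that a relation
-- cannot distinguish two tuples with the same entries.
Relation : ℕ → Set → Set₁
Relation n X = Pred (Vec X n) 0ℓ

record Structure (L : Language) : Set₁ where
  field
    Carrier : Set
    rel     : ∀ R → Relation (arity L R) Carrier

open Structure public

module _ {L : Language} where

  record Embedding (A B : Structure L) : Set where
    field
      to        : Carrier A → Carrier B
      injective : Injective _≡_ _≡_ to
      rel⇔      : ∀ R as → rel A R as ⇔ rel B R (map to as)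

  open Embedding public

  infixr 9 _∘ᵉ_
  _∘ᵉ_ : {A B C : Structure L} → Embedding B C → Embedding A B → Embedding A C
  _∘ᵉ_ {A} {B} {C} g f = record
    { to        = to g ∘ to f
    ; injective = injective f ∘ injective g
    ; rel⇔      = λ R as → subst (λ cs → rel A R as ⇔ rel C R cs)
        (sym (map-∘ (to g) (to f) as))
        (mk⇔ (Equivalence.to (rel⇔ g R (map (to f) as)) ∘ Equivalence.to (rel⇔ f R as))
             (Equivalence.from (rel⇔ f R as) ∘ Equivalence.from (rel⇔ g R (map (to f) as))))
    }

  -- Membership proofs are irrelevant in the refinement type, so the universe
  -- of K ↾ S has exactly one element for each element of S.
  infixl 8 _↾_
  _↾_ : (K : Structure L) → Pred (Carrier K) 0ℓ → Structure L
  K ↾ S = record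
    { Carrier = Refinement (Carrier K) S
    ; rel     = λ R as → rel K R (map value as)
    }

  inclusion : (K : Structure L) (S : Pred (Carrier K) 0ℓ) → Embedding (K ↾ S) K
  inclusion K S = record
    { to        = value
    ; injective = value-injective
    ; rel⇔      = λ R as → ⇔-id _
    }

  record Copy (A B : Structure L) : Set₁ where
    field
      universe  : Pred (Carrier B) 0ℓ
      embedding : Embedding A B
      isImage   : universe ≐ image (to embedding) U

  open Copy public

  -- A copy is only a subset of B: copies with the same universe are equal,
  -- whichever embedding witnesses that the universe is an image.
  Copies : (A B : Structure L) → Setoid (suc 0ℓ) 0ℓ
  Copies A B = On.setoid (≐-setoid (Carrier B) 0ℓ) (universe {A} {B})

  -- Colourings are setoid maps, i.e. functions of the universe of a copy.
  Colouring : (A K : Structure L) → ℕ → Set₁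
  Colouring A K k = Func (Copies A K) (setoid (Fin k))

  -- For g the inclusion of a substructure, this regards a copy of A in the
  -- substructure as a copy of A in the ambient structure.
  pushforward : {A B C : Structure L} → Embedding B C → Copy A B → Copy A C
  pushforward g B′ = record
    { universe  = image (to g) (universe B′)
    ; embedding = g ∘ᵉ embedding B′
    ; isImage   =
        (λ { (b , b∈B′ , refl) → let (a , _ , fa≡b) = proj₁ (isImage B′) b∈B′
                                 in a , tt , cong (to g) fa≡b })
      , (λ { (a , _ , refl) → to (embedding B′) a
                            , proj₂ (isImage B′) (a , tt , refl) , refl })
    }

  -- The set of colours attained on the copies of A inside K ↾ S.
  coloursOn : {A K : Structure L} {k : ℕ} →
              Colouring A K k → Pred (Carrier K) 0ℓ → Pred (Fin k) (suc 0ℓ)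
  coloursOn {A} {K} c S j =
    Σ (Copy A (K ↾ S)) λ B → Func.to c (pushforward (inclusion K S) B) ≡ j

  RamseyBound : (A K : Structure L) → ℕ → Set₁
  RamseyBound A K t =
    ∀ k (c : Colouring A K k) →
    Σ (Copy K K) λ K′ → HasCardinality≤ (coloursOn c (universe K′)) t

  IsBigRamseyDegree : (A K : Structure L) → ℕ → Set₁
  IsBigRamseyDegree A K t = RamseyBound A K t × (∀ s → RamseyBound A K s → t ≤ s)

  FiniteBigRamseyDegree : (A K : Structure L) → Set₁
  FiniteBigRamseyDegree A K = ∃[ t ] IsBigRamseyDegree A K t

infixl 8 _↾ʳ_
_↾ʳ_ : {X : Set} {d : ℕ} → Relation d X → Pred X 0ℓ → Relation d X
R ↾ʳ S = R ∩ All S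

{-# OPTIONS --safe #-}

-- Colour d-tuples instead of copies.  Some T bounds the number of colours that
-- a suitable copy of K leaves on its d-tuples, whatever the finite colouring:
-- for each of the finitely many isomorphism types A of d-element
-- substructures, colour a copy of A by the set of colours of the tuples with
-- entries in that copy.  For the least such T there is a persistent colouring
-- c, which attains at least T colours on every copy of K.  Given R, pass to a
-- copy where c × R attains at most T colours: there R is a function of c, and
-- there are only finitely many functions of c.  Colouring tuples also avoids
-- the choice of an enumeration of each d-element subset.
module Submission where

open import Axiom.ExcludedMiddle using (ExcludedMiddle)
open import Data.Bool.Base using (true; false)
open import Data.Empty using (⊥; ⊥-elim)
open import Data.Fin.Base using (Fin; zero; suc; combine; remQuot; finToFun; funToFin)
open import Data.Fin.Patterns using (0F; 1F)
open import Data.Fin.Properties using (remQuot-combine; combine-injectiveʳ; finToFun-funToFin)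
open import Data.Fin.Subset using (Subset; ∣_∣)
import Data.Fin.Subset as Subset
open import Data.List.Base
  using (List; []; _∷_; _++_; length; concatMap; cartesianProductWith; allFin)
import Data.List.Base as List
open import Data.List.Membership.Propositional using (_∈_)
open import Data.List.Membership.Propositional.Properties
  using (∈-map⁺; ∈-++⁺ˡ; ∈-++⁺ʳ; ∈-++⁻; ∈-∃++; ∈-concat⁺′; ∈-tabulate⁺; ∈-allFin;
         ∈-cartesianProductWith⁺)
open import Data.List.Properties using (length-map; length-++; length-++-sucʳ)
open import Data.List.Relation.Unary.Any using (here; there)
open import Data.Nat.Base using (ℕ; zero; suc; _+_; _*_; _^_; _<_; _≤_; z≤n)
open import Data.Nat.Properties using (≤-reflexive; ≤-trans; <-irrefl; +-mono-≤; *-monoˡ-≤; ≰⇒>)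
open import Data.Product.Base using (Σ; ∃-syntax; _×_; _,_; proj₁; proj₂)
open import Data.Refinement using (Refinement; value; value-injective) renaming (_,_ to _,ᵣ_)
open import Data.Irrelevant using ([_])
open import Data.Sum.Base using (_⊎_; inj₁; inj₂)
open import Data.Unit.Base using (⊤; tt)
open import Data.Vec.Base using (Vec; []; _∷_; map)
import Data.Vec.Base as Vec
open import Data.Vec.Properties using (map-id; map-∘; map-cong)
open import Data.Vec.Relation.Unary.All as All using (All; []; _∷_)
open import Function.Base using (_∘_; id)
open import Function.Bundles using (_⇔_; mk⇔; mk↔ₛ′; Equivalence; Inverse)
open import Function.Construct.Composition using (_⇔-∘_)
open import Function.Construct.Identity using (⇔-id)
open import Function.Definitions using (Injective)
open import Level using (0ℓ)
open import Relation.Binary.PropositionalEquality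
open import Relation.Nullary using (¬_; Dec; yes; no; recompute; contradiction)
open import Relation.Unary using (Pred; U; _≐_)
open import Defs

-- Finite lists and vectors.

allVecs : ∀ d n → List (Vec (Fin d) n)
allVecs d zero    = [] ∷ []
allVecs d (suc n) = cartesianProductWith _∷_ (allFin d) (allVecs d n)

∈-allVecs : ∀ {d n} (p : Vec (Fin d) n) → p ∈ allVecs d n
∈-allVecs []      = here refl
∈-allVecs (i ∷ p) = ∈-cartesianProductWith⁺ _∷_ (∈-allFin i) (∈-allVecs p)

elements : ∀ {n} (D : Subset n) →
           Σ (List (Fin n)) λ js → length js ≡ ∣ D ∣ × (∀ {j} → j Subset.∈ D → j ∈ js)
elements []          = [] , refl , λ ()
elements (true ∷ D)  = let js , len , all = elements D in
  zero ∷ List.map suc js , cong suc (trans (length-map suc js) len) ,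
  λ { Vec.here → here refl ; (Vec.there j∈D) → there (∈-map⁺ suc (all j∈D)) }
elements (false ∷ D) = let js , len , all = elements D in
  List.map suc js , trans (length-map suc js) len ,
  λ { (Vec.there j∈D) → ∈-map⁺ suc (all j∈D) }

length-concatMap-≤ : {A B : Set} (f : A → List B) {N : ℕ} → (∀ x → length (f x) ≤ N) →
                     ∀ xs → length (concatMap f xs) ≤ length xs * N
length-concatMap-≤ f f≤N []       = z≤n
length-concatMap-≤ f f≤N (x ∷ xs) =
  ≤-trans (≤-reflexive (length-++ (f x))) (+-mono-≤ (f≤N x) (length-concatMap-≤ f f≤N xs))

-- One occurrence of `a` can be deleted before mapping: `b` survives the deletion because `a ≢ b`,
-- and it supplies the value `h a`.
image-of-collision : {A B : Set} (h : A → B) {a b : A} (xs : List A) →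
                     a ∈ xs → b ∈ xs → a ≢ b → h a ≡ h b →
                     Σ (List B) λ ys → length ys < length xs × (∀ {x} → x ∈ xs → h x ∈ ys)
image-of-collision h {a} {b} xs a∈xs b∈xs a≢b ha≡hb with ∈-∃++ a∈xs
... | ys , zs , refl = List.map h (ys ++ zs) , shorter , hit
  where
  split : ∀ {x} → x ∈ ys ++ a ∷ zs → x ≡ a ⊎ x ∈ ys ++ zs
  split x∈ with ∈-++⁻ ys x∈
  ... | inj₁ x∈ys          = inj₂ (∈-++⁺ˡ x∈ys)
  ... | inj₂ (here x≡a)    = inj₁ x≡a
  ... | inj₂ (there x∈zs)  = inj₂ (∈-++⁺ʳ ys x∈zs)

  shorter : length (List.map h (ys ++ zs)) < length (ys ++ a ∷ zs)
  shorter = ≤-reflexive (trans (cong suc (length-map h (ys ++ zs))) (sym (length-++-sucʳ ys a zs)))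

  hit : ∀ {x} → x ∈ ys ++ a ∷ zs → h x ∈ List.map h (ys ++ zs)
  hit x∈ with split x∈
  ... | inj₂ x∈′  = ∈-map⁺ h x∈′
  ... | inj₁ refl with split b∈xs
  ...   | inj₁ b≡a = contradiction (sym b≡a) a≢b
  ...   | inj₂ b∈′ = subst (_∈ List.map h (ys ++ zs)) (sym ha≡hb) (∈-map⁺ h b∈′)

funToFin-cong : ∀ {m n} {f g : Fin m → Fin n} → (∀ i → f i ≡ g i) → funToFin f ≡ funToFin g
funToFin-cong {zero}  f≗g = refl
funToFin-cong {suc m} f≗g = cong₂ combine (f≗g zero) (funToFin-cong (f≗g ∘ suc))

All-image⇒map : {X Y : Set} {f : X → Y} {P : Pred Y 0ℓ} → (∀ {y} → P y → ∃[ x ] f x ≡ y) →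
                ∀ {n} {ys : Vec Y n} → All P ys → ∃[ xs ] map f xs ≡ ys
All-image⇒map pre []         = [] , refl
All-image⇒map pre (py ∷ pys) =
  let x , fx≡y = pre py ; xs , eq = All-image⇒map pre pys in x ∷ xs , cong₂ _∷_ fx≡y eq

All-map : {X Y : Set} {f : X → Y} {P : Pred Y 0ℓ} → (∀ x → P (f x)) →
          ∀ {n} (xs : Vec X n) → All P (map f xs)
All-map Pf []       = []
All-map Pf (x ∷ xs) = Pf x ∷ All-map Pf xs

-- Coding subsets of a finite set.

bit : {P : Set} → Dec P → Fin 2
bit (yes _) = 1F
bit (no _)  = 0F

bit-true : {P : Set} (P? : Dec P) → P → bit P? ≡ 1F
bit-true (yes _) p = refl
bit-true (no ¬p) p = contradiction p ¬p

bit-false : {P : Set} (P? : Dec P) → ¬ P → bit P? ≡ 0F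
bit-false (yes p) ¬p = contradiction p ¬p
bit-false (no _)  ¬p = refl

bit-sound : {P : Set} (P? : Dec P) → bit P? ≡ 1F → P
bit-sound (yes p) _ = p

bit-cong : {P Q : Set} (P? : Dec P) (Q? : Dec Q) → (P → Q) → (Q → P) → bit P? ≡ bit Q?
bit-cong (yes p) Q? f g = sym (bit-true Q? (f p))
bit-cong (no ¬p) Q? f g = sym (bit-false Q? (¬p ∘ g))

-- A number below `2 ^ k` is read as a characteristic function, so that a set of colours can itself
-- serve as a colour.
Member : ∀ {k} → Fin (2 ^ k) → Pred (Fin k) 0ℓ
Member {k} j i = finToFun {2} {k} j i ≡ 1F

module _ (lem : ExcludedMiddle 0ℓ) where

  encode : ∀ {k} → Pred (Fin k) 0ℓ → Fin (2 ^ k)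
  encode P = funToFin λ i → bit (lem {P i})

  encode-cong : ∀ {k} (P Q : Pred (Fin k) 0ℓ) → P ≐ Q → encode P ≡ encode Q
  encode-cong P Q (P⊆Q , Q⊆P) = funToFin-cong {n = 2} λ i → bit-cong (lem {P i}) (lem {Q i}) P⊆Q Q⊆P

  Member-encode⁺ : ∀ {k} (P : Pred (Fin k) 0ℓ) {i} → P i → Member (encode P) i
  Member-encode⁺ P {i} p = trans (finToFun-funToFin _ i) (bit-true lem p)

  Member-encode⁻ : ∀ {k} (P : Pred (Fin k) 0ℓ) {i} → Member (encode P) i → P i
  Member-encode⁻ P {i} m = bit-sound (lem {P i}) (trans (sym (finToFun-funToFin _ i)) m)

  -- The membership proof inside `x` is irrelevant; excluded middle decides the existential, which
  -- allows a usable index to be recomputed.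
  position : {X : Set} {n : ℕ} (w : Fin n → X) (x : Refinement X λ x → ∃[ i ] w i ≡ x) →
             ∃[ i ] w i ≡ value x
  position w (x ,ᵣ [ w∋x ]) = recompute lem w∋x

  -- Tuples inside sets of distinct elements.

  module _ {X : Set} (infinite : Infinite X) where

    fresh : ∀ {n} (w : Fin n → X) → Injective _≡_ _≡_ w → ∃[ x ] (∀ i → w i ≢ x)
    fresh {n} w inj with lem {∃[ x ] (∀ i → w i ≢ x)}
    ... | yes found = found
    ... | no  none  = contradiction
      (n , mk↔ₛ′ w (proj₁ ∘ hit) (proj₂ ∘ hit) (λ i → inj (proj₂ (hit (w i))))) infinite
      where
      hit : ∀ x → ∃[ i ] w i ≡ x
      hit x with lem {∃[ i ] w i ≡ x}
      ... | yes found = found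
      ... | no  ¬hit  = contradiction (x , λ i wi≡x → ¬hit (i , wi≡x)) none

    -- A tuple with repeated entries has too small a set of entries, so that set is padded to
    -- exactly `n` elements, the size to which a hypothesis on `n`-element substructures applies.
    cover : ∀ {n} (v : Vec X n) →
            Σ (Fin n → X) λ w → Injective _≡_ _≡_ w × ∃[ p ] map w p ≡ v
    cover []      = (λ ()) , (λ { {()} }) , [] , refl
    cover (x ∷ v) with cover v
    ... | w , inj , p , refl = result
      where
      module _ (y : X) (y∉w : ∀ i → w i ≢ y) where
        w′ : Fin _ → X
        w′ zero    = y
        w′ (suc i) = w i

        inj′ : Injective _≡_ _≡_ w′
        inj′ {zero}  {zero}  _  = refl
        inj′ {zero}  {suc j} eq = contradiction (sym eq) (y∉w j)
        inj′ {suc i} {zero}  eq = contradiction eq (y∉w i)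
        inj′ {suc i} {suc j} eq = cong suc (inj eq)

      result : Σ (Fin _ → X) λ w′ → Injective _≡_ _≡_ w′ × ∃[ q ] map w′ q ≡ x ∷ map w p
      result with lem {∃[ i ] w i ≡ x}
      ... | yes (i , wi≡x) = let y , y∉w = fresh w inj in
        w′ y y∉w , inj′ y y∉w , suc i ∷ map suc p , cong₂ _∷_ wi≡x (sym (map-∘ _ suc p))
      ... | no ¬hit = let x∉w = λ i wi≡x → ¬hit (i , wi≡x) in
        w′ x x∉w , inj′ x x∉w , zero ∷ map suc p , cong (x ∷_) (sym (map-∘ _ suc p))

  -- Colourings of tuples and persistence.

  module _ {L : Language} (K : Structure L) where

    idᵉ : Embedding K K
    idᵉ = record
      { to        = id
      ; injective = id
      ; rel⇔      = λ R as → subst (λ bs → rel K R as ⇔ rel K R bs) (sym (map-id as)) (⇔-id _)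
      }

    TupleBound : ℕ → ℕ → Set
    TupleBound d T = ∀ k (χ : Vec (Carrier K) d → Fin k) →
      Σ (Embedding K K) λ e → Σ (List (Fin k)) λ xs →
        length xs ≤ T × (∀ v → χ (map (to e) v) ∈ xs)

    Persistent : ∀ {d k} → (Vec (Carrier K) d → Fin k) → ℕ → Set
    Persistent χ T = ∀ (e : Embedding K K) xs → (∀ v → χ (map (to e) v) ∈ xs) → T ≤ length xs

    -- Descent on `T`: if no colouring is persistent for `suc T`, then each can be reduced to at
    -- most `T` colours, so `T` is again a bound. At zero any colouring is persistent.
    persistent-colouring : ∀ {d} T → TupleBound d T →
      ∃[ T′ ] TupleBound d T′ × ∃[ k ] Σ (Vec (Carrier K) d → Fin k) λ χ → Persistent χ T′
    persistent-colouring zero bound = 0 , bound , 1 , (λ _ → zero) , λ _ _ _ → z≤n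
    persistent-colouring {d} (suc T) bound
      with lem {∃[ k ] Σ (Vec (Carrier K) d → Fin k) λ χ → Persistent χ (suc T)}
    ... | yes found = suc T , bound , found
    ... | no  none  = persistent-colouring T smaller
      where
      smaller : TupleBound d T
      smaller k χ with lem {Σ (Embedding K K) λ e → Σ (List (Fin k)) λ xs →
                             length xs ≤ T × (∀ v → χ (map (to e) v) ∈ xs)}
      ... | yes found = found
      ... | no  ¬few  = contradiction
        (k , χ , λ e xs hit → ≰⇒> λ len → ¬few (e , xs , len , hit)) none

    -- Bounds on classes of enumerated `d`-element sets.

    module _ (d : ℕ) where

      Enum : Set
      Enum = Fin d → Carrier K

      ClosedUnderEmbeddings : Pred Enum 0ℓ → Set
      ClosedUnderEmbeddings P = ∀ (e : Embedding K K) {w} → P w → P (to e ∘ w)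

      -- TupleBound for the tuples with entries in a set enumerated by a member of P.
      BoundOn : Pred Enum 0ℓ → Set
      BoundOn P = ∃[ T ] ∀ k (χ : Vec (Carrier K) d → Fin k) →
        Σ (Embedding K K) λ e → Σ (List (Fin k)) λ xs → length xs ≤ T ×
          (∀ w → Injective _≡_ _≡_ w → P w → ∀ p → χ (map (to e ∘ w) p) ∈ xs)

      -- The class `Q` is treated first, by `e₂`; then `P` is treated for the colouring pulled back
      -- along `e₂`. Closure of `Q` ensures that passing further to `e₁` preserves what was achieved
      -- for `Q`.
      BoundOn-union : ∀ {P Q R : Pred Enum 0ℓ} → ClosedUnderEmbeddings Q →
        (∀ {w} → R w → P w ⊎ Q w) → BoundOn P → BoundOn Q → BoundOn R
      BoundOn-union {P} {Q} {R} closed split (T₁ , b₁) (T₂ , b₂) = T₂ + T₁ , bound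
        where
        bound : ∀ k (χ : Vec (Carrier K) d → Fin k) → _
        bound k χ with b₂ k χ
        ... | e₂ , xs₂ , len₂ , hit₂ with b₁ k (χ ∘ map (to e₂))
        ...   | e₁ , xs₁ , len₁ , hit₁ =
          e₂ ∘ᵉ e₁ , xs₂ ++ xs₁ , ≤-trans (≤-reflexive (length-++ xs₂)) (+-mono-≤ len₂ len₁) , hit
          where
          hit : ∀ w → Injective _≡_ _≡_ w → R w → ∀ p → χ (map (to e₂ ∘ to e₁ ∘ w) p) ∈ xs₂ ++ xs₁
          hit w inj r p with split r
          ... | inj₁ Pw = ∈-++⁺ʳ xs₂
            (subst (λ v → χ v ∈ xs₁) (sym (map-∘ (to e₂) (to e₁ ∘ w) p)) (hit₁ w inj Pw p))
          ... | inj₂ Qw = ∈-++⁺ˡ (hit₂ (to e₁ ∘ w) (inj ∘ injective e₁) (closed e₁ Qw) p)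

      -- Atomic formulas in `d` variables. Equality is left out because the enumerations compared
      -- are injective.
      Test : Set
      Test = Σ (Symbol L) λ R → Vec (Fin d) (arity L R)

      _⊩_ : Enum → Test → Set
      w ⊩ (R , p) = rel K R (map w p)

      ⊩-embedding : ∀ (e : Embedding K K) w t → w ⊩ t ⇔ (to e ∘ w) ⊩ t
      ⊩-embedding e w (R , p) =
        subst (λ v → rel K R (map w p) ⇔ rel K R v) (sym (map-∘ (to e) w p)) (rel⇔ e R (map w p))

      -- The bound for one isomorphism type, represented by `w₀`.

      module SingleType
        (w₀ : Enum) (w₀-inj : Injective _≡_ _≡_ w₀)
        (P : Pred Enum 0ℓ) (iso : ∀ {w} → P w → ∀ t → w₀ ⊩ t ⇔ w ⊩ t)
        where

        S : Pred (Carrier K) 0ℓ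
        S x = ∃[ i ] w₀ i ≡ x

        A : Structure L
        A = K ↾ S

        index : Carrier A → Fin d
        index x = proj₁ (position w₀ x)

        w₀-index : ∀ x → w₀ (index x) ≡ value x
        w₀-index x = proj₂ (position w₀ x)

        element : Fin d → Carrier A
        element i = w₀ i ,ᵣ [ i , refl ]

        index-element : ∀ i → index (element i) ≡ i
        index-element i = w₀-inj (w₀-index (element i))

        A-cardinality : HasCardinality (Carrier A) d
        A-cardinality = mk↔ₛ′ element index (λ x → value-injective (w₀-index x)) index-element

        module _ (K′ : Copy K K) (w : Enum) (w-inj : Injective _≡_ _≡_ w) (Pw : P w) where

          private
            e : Embedding K K
            e = embedding K′

          -- The map sends `w₀ i` to `to e (w i)`. Relations are carried from `w₀` to `w` by `iso`,
          -- and from `w` to its image by `⊩-embedding`.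
          copy-embedding : Embedding A (K ↾ universe K′)
          copy-embedding = record
            { to        = f
            ; injective = λ {x} {y} eq → value-injective (trans (sym (w₀-index x))
                (trans (cong w₀ (w-inj (injective e (cong value eq)))) (w₀-index y)))
            ; rel⇔      = λ R as →
                subst₂ (λ as′ bs′ → rel K R as′ ⇔ rel K R bs′) (source as) (target as)
                  (⊩-embedding e w (R , map index as) ⇔-∘ iso Pw (R , map index as))
            }
            where
            f : Carrier A → Carrier (K ↾ universe K′)
            f x = to e (w (index x)) ,ᵣ [ proj₂ (isImage K′) (w (index x) , tt , refl) ]

            source : ∀ {n} (as : Vec (Carrier A) n) → map w₀ (map index as) ≡ map value as
            source as = trans (sym (map-∘ w₀ index as)) (map-cong w₀-index as)

            target : ∀ {n} (as : Vec (Carrier A) n) →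
                     map (to e ∘ w) (map index as) ≡ map value (map f as)
            target as = trans (sym (map-∘ (to e ∘ w) index as)) (map-∘ value f as)

          copy : Copy A (K ↾ universe K′)
          copy = record
            { universe  = image (to copy-embedding) U
            ; embedding = copy-embedding
            ; isImage   = id , id
            }

          pushed : Pred (Carrier K) 0ℓ
          pushed = universe (pushforward (inclusion K (universe K′)) copy)

          ∈pushed : ∀ i → pushed (to e (w i))
          ∈pushed i = _ , (element i , tt , refl) , cong (to e ∘ w) (index-element i)

          pushed⇒ : ∀ {y} → pushed y → ∃[ i ] to e (w i) ≡ y
          pushed⇒ (_ , (x , _ , refl) , refl) = index x , refl

        module _ {k : ℕ} (χ : Vec (Carrier K) d → Fin k) where

          ValueOn : Pred (Carrier K) 0ℓ → Pred (Fin k) 0ℓ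
          ValueOn B i = ∃[ v ] All B v × χ v ≡ i

          -- The set of all values of `χ` depends only on the universe of the copy. The larger
          -- number of colours is harmless, since a big Ramsey degree bounds colourings with any
          -- number of colours.
          palette : Colouring A K (2 ^ k)
          palette = record
            { to   = λ B → encode (ValueOn (universe B))
            ; cong = λ {B} {C} (B⊆C , C⊆B) →
                encode-cong (ValueOn (universe B)) (ValueOn (universe C))
                ( (λ (v , inB , eq) → v , All.map B⊆C inB , eq)
                , (λ (v , inC , eq) → v , All.map C⊆B inC , eq))
            }

          -- The length of `allVecs d d` is the number of `d`-tuples from a `d`-element set, hence
          -- the most values that `χ` can take on one copy.
          Values : Fin (2 ^ k) → Set
          Values j = Σ (List (Fin k)) λ xs →
            length xs ≤ length (allVecs d d) × (∀ i → Member j i → i ∈ xs)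

          -- Codes of sets that are too large do not occur as colours.
          values : Fin (2 ^ k) → List (Fin k)
          values j with lem {Values j}
          ... | yes (xs , _) = xs
          ... | no _         = []

          length-values : ∀ j → length (values j) ≤ length (allVecs d d)
          length-values j with lem {Values j}
          ... | yes (_ , len , _) = len
          ... | no _              = z≤n

          ∈-values : ∀ {j} → Values j → ∀ {i} → Member j i → i ∈ values j
          ∈-values {j} small m with lem {Values j}
          ... | yes (_ , _ , hit) = hit _ m
          ... | no ¬small         = contradiction small ¬small

          module _ (K′ : Copy K K) (w : Enum) (w-inj : Injective _≡_ _≡_ w) (Pw : P w) where

            private
              f : Enum
              f = to (embedding K′) ∘ w

            colour : Fin (2 ^ k)
            colour = encode (ValueOn (pushed K′ w w-inj Pw))

            small-palette : Values colour
            small-palette =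
              List.map (χ ∘ map f) (allVecs d d) , ≤-reflexive (length-map _ (allVecs d d)) , hit
              where
              hit : ∀ i → Member colour i → i ∈ List.map (χ ∘ map f) (allVecs d d)
              hit i m with Member-encode⁻ (ValueOn (pushed K′ w w-inj Pw)) m
              ... | v , inB , refl with All-image⇒map {f = f} (pushed⇒ K′ w w-inj Pw) inB
              ...   | p , refl = ∈-map⁺ (χ ∘ map f) (∈-allVecs p)

            ∈-values-colour : ∀ p → χ (map f p) ∈ values colour
            ∈-values-colour p = ∈-values small-palette
              (Member-encode⁺ (ValueOn (pushed K′ w w-inj Pw))
                (map f p , All-map (∈pushed K′ w w-inj Pw) p , refl))

        -- At most `t` palettes remain on a suitable copy, and each contributes at most
        -- `length (allVecs d d)` values of `χ`.
        bound : FiniteBigRamseyDegree A K → BoundOn P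
        bound (t , ramsey , _) = t * length (allVecs d d) , λ k χ →
          let K′ , D , (colours⊆D , _) , ∣D∣≤t = ramsey (2 ^ k) (palette χ)
              js , len , D⊆js                  = elements D
          in embedding K′ , concatMap (values χ) js ,
             ≤-trans (length-concatMap-≤ (values χ) (length-values χ) js)
                     (*-monoˡ-≤ (length (allVecs d d)) (≤-trans (≤-reflexive len) ∣D∣≤t)) ,
             λ w w-inj Pw p → ∈-concat⁺′ (∈-values-colour χ K′ w w-inj Pw p)
               (∈-map⁺ (values χ) (D⊆js (colours⊆D (copy K′ w w-inj Pw , refl))))

      -- Splitting into finitely many isomorphism types.

      module _ (degrees : (S : Pred (Carrier K) 0ℓ) → HasCardinality (Carrier (K ↾ S)) d →
                          FiniteBigRamseyDegree (K ↾ S) K) where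

        -- Each test in `ts` splits the class by its truth value. Once `ts` is exhausted, any two
        -- members of the class satisfy the same tests, so `SingleType` applies.
        BoundOn-tests : (ts : List Test) (P : Pred Enum 0ℓ) → ClosedUnderEmbeddings P →
          (∀ {v w} → P v → P w → (∀ {t} → t ∈ ts → v ⊩ t ⇔ w ⊩ t) → ∀ t → v ⊩ t ⇔ w ⊩ t) →
          BoundOn P
        BoundOn-tests [] P closed iso with lem {∃[ w ] Injective _≡_ _≡_ w × P w}
        ... | yes (w₀ , inj , Pw₀) = bound (degrees S A-cardinality)
          where open SingleType w₀ inj P (λ Pw → iso Pw₀ Pw λ ())
        -- This combination of truth values is not realised by any injective enumeration, so no
        -- colour has to be listed.
        ... | no empty = 0 , λ k χ →
          idᵉ , [] , z≤n , λ w inj Pw → ⊥-elim (empty (w , inj , Pw))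
        BoundOn-tests (t ∷ ts) P closed iso = BoundOn-union closed⁻ split
          (BoundOn-tests ts P⁺ closed⁺ λ (Pv , v⊩t) (Pw , w⊩t) agree → iso Pv Pw
            λ { (here refl) → mk⇔ (λ _ → w⊩t) (λ _ → v⊩t) ; (there t∈) → agree t∈ })
          (BoundOn-tests ts P⁻ closed⁻ λ (Pv , v⊮t) (Pw , w⊮t) agree → iso Pv Pw
            λ { (here refl) → mk⇔ (λ v⊩t → contradiction v⊩t v⊮t) (λ w⊩t → contradiction w⊩t w⊮t)
              ; (there t∈) → agree t∈ })
          where
          P⁺ P⁻ : Pred Enum 0ℓ
          P⁺ w = P w × w ⊩ t
          P⁻ w = P w × ¬ (w ⊩ t)

          closed⁺ : ClosedUnderEmbeddings P⁺
          closed⁺ e {w} (Pw , w⊩t) = closed e Pw , Equivalence.to (⊩-embedding e w t) w⊩t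

          closed⁻ : ClosedUnderEmbeddings P⁻
          closed⁻ e {w} (Pw , w⊮t) = closed e Pw , w⊮t ∘ Equivalence.from (⊩-embedding e w t)

          split : ∀ {w} → P w → P⁺ w ⊎ P⁻ w
          split {w} Pw with lem {w ⊩ t}
          ... | yes w⊩t = inj₁ (Pw , w⊩t)
          ... | no  w⊮t = inj₂ (Pw , w⊮t)

        module _ (finite : FiniteLanguage L) (infinite : Infinite (Carrier K)) where

          open Inverse (proj₂ finite) using ()
            renaming (to to symbol; from to symbol⁻¹; strictlyInverseˡ to symbol-symbol⁻¹)

          testsFor : Symbol L → List Test
          testsFor R = List.map (R ,_) (allVecs d (arity L R))

          tests : List Test
          tests = concatMap (testsFor ∘ symbol) (allFin (proj₁ finite))

          ∈-tests : ∀ t → t ∈ tests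
          ∈-tests (R , p) = ∈-concat⁺′
            (subst (λ R′ → (R , p) ∈ testsFor R′) (sym (symbol-symbol⁻¹ R))
              (∈-map⁺ (R ,_) (∈-allVecs p)))
            (∈-map⁺ (testsFor ∘ symbol) (∈-allFin (symbol⁻¹ R)))

          tuple-bound : ∃[ T ] TupleBound d T
          tuple-bound = let T , b = everywhere in T , λ k χ →
            let e , xs , len , hit = b k χ in e , xs , len , λ v → hits χ e hit v
            where
            everywhere : BoundOn (λ _ → ⊤)
            everywhere = BoundOn-tests tests (λ _ → ⊤) (λ _ _ → tt)
              λ _ _ agree t → agree (∈-tests t)

            hits : ∀ {k} (χ : Vec (Carrier K) d → Fin k) (e : Embedding K K) {xs} →
                   (∀ w → Injective _≡_ _≡_ w → ⊤ → ∀ p → χ (map (to e ∘ w) p) ∈ xs) →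
                   ∀ v → χ (map (to e) v) ∈ xs
            hits χ e hit v with cover infinite v
            -- Every tuple, with or without repetitions, is drawn from an injective enumeration `w`.
            ... | w , inj , p , refl = subst (λ u → χ u ∈ _) (map-∘ (to e) w p) (hit w inj tt p)

    -- Every relation as a function of a persistent colouring.

    relation-from-colouring : ∀ {d T} → TupleBound d T →
      ∀ {k} (c : Vec (Carrier K) d → Fin k) → Persistent c T → (R : Relation d (Carrier K)) →
      ∃[ j ] Σ (Copy K K) λ K′ → (R ↾ʳ universe K′) ≐ ((Member j ∘ c) ↾ʳ universe K′)
    relation-from-colouring {d} {T} bound {k} c persistent R = j , K′ , ⊆ , ⊇
      where
      product : Vec (Carrier K) d → Fin (k * 2)
      product v = combine (c v) (bit (lem {R v}))

      reduced = bound (k * 2) product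
      e   = proj₁ reduced
      xs  = proj₁ (proj₂ reduced)
      len = proj₁ (proj₂ (proj₂ reduced))
      hit = proj₂ (proj₂ (proj₂ reduced))

      K′ : Copy K K
      K′ = record { universe = image (to e) U ; embedding = e ; isImage = id , id }

      inImage : ∀ {v : Vec (Carrier K) d} → All (universe K′) v → ∃[ u ] map (to e) u ≡ v
      inImage = All-image⇒map λ (x , _ , eq) → x , eq

      -- The colours of `c` on which `R` is to hold. The list `xs` may contain unattained colours,
      -- but `no-collision` bounds pairs in the list itself, so membership in `xs` suffices.
      Positive : Pred (Fin k) 0ℓ
      Positive i = combine i 1F ∈ xs

      j : Fin (2 ^ k)
      j = encode Positive

      hit-with : ∀ {v} → All (universe K′) v → ∀ {b} → bit (lem {R v}) ≡ b → combine (c v) b ∈ xs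
      hit-with inK′ refl with inImage inK′
      ... | u , refl = hit u

      ⊆ : ∀ {v} → (R ↾ʳ universe K′) v → ((Member j ∘ c) ↾ʳ universe K′) v
      ⊆ (Rv , inK′) = Member-encode⁺ Positive (hit-with inK′ (bit-true lem Rv)) , inK′

      h : Fin (k * 2) → Fin k
      h = proj₁ ∘ remQuot {k} 2

      h-combine : ∀ i b → h (combine i b) ≡ i
      h-combine i b = cong proj₁ (remQuot-combine i b)

      -- Two values of product over one value of c would leave c fewer than T values.
      no-collision : ∀ i → combine i 0F ∈ xs → combine i 1F ∈ xs → ⊥
      no-collision i 0∈ 1∈ with image-of-collision h xs 0∈ 1∈
          (λ eq → contradiction (combine-injectiveʳ i 0F i 1F eq) λ ())
          (trans (h-combine i 0F) (sym (h-combine i 1F)))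
      ... | ys , shorter , hit′ = <-irrefl refl (≤-trans shorter (≤-trans len
        (persistent e ys λ v → subst (_∈ ys) (h-combine _ _) (hit′ (hit v)))))

      ⊇ : ∀ {v} → ((Member j ∘ c) ↾ʳ universe K′) v → (R ↾ʳ universe K′) v
      ⊇ {v} (m , inK′) = positive lem , inK′
        where
        positive : Dec (R v) → R v
        positive (yes Rv) = Rv
        positive (no ¬Rv) = ⊥-elim (no-collision (c v)
          (hit-with inK′ (bit-false lem ¬Rv)) (Member-encode⁻ Positive m))

theorem1p1 : ExcludedMiddle 0ℓ →
    (L : Language) → FiniteLanguage L → NoUnarySymbols L →
    (K : Structure L) → Infinite (Carrier K) →
    (d : ℕ) → 0 < d →
    ((S : Pred (Carrier K) 0ℓ) → HasCardinality (Carrier (K ↾ S)) d →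
    FiniteBigRamseyDegree (K ↾ S) K) →
    Σ (List (Relation d (Carrier K))) λ ℛ →
    (R : Relation d (Carrier K)) →
    Σ (Relation d (Carrier K)) λ R̃ → (R̃ ∈ ℛ) ×
    Σ (Copy K K) λ K′ → (R ↾ʳ universe K′) ≐ (R̃ ↾ʳ universe K′)
theorem1p1 lem L finite _ K infinite d _ degrees
  with T , bound ← tuple-bound lem K d degrees finite infinite
  with T′ , bound′ , k , c , persistent ← persistent-colouring lem K T bound =
  -- The candidates are the preimages under `c` of the `2 ^ k` subsets of `Fin k`; they are fixed
  -- before `R` is given.
  List.tabulate relation , λ R →
    let j , K′ , eq = relation-from-colouring lem K bound′ c persistent R
    in relation j , ∈-tabulate⁺ j , K′ , eq
  where
  relation : Fin (2 ^ k) → Relation d (Carrier K)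
  relation j v = Member j (c v)
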